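{- Let $d\ge 1$ be an integer. Then $$\gamma_d^{\mathrm L}(Q_{d+1})=\gamma_t(Q_{d+1})=2\,\gamma(Q_d).$$
   Context: All graphs are finite and simple; $N_G(u)$ is the open neighborhood of $u$ in $G$. A set $D\subseteq V(G)$ is a dominating set if every vertex of $V(G)\setminus D$ has a neighbor in $D$; $\gamma(G)$ is the minimum cardinality of a dominating set of $G$. A total dominating set is a set $D\subseteq V(G)$ such that every vertex of $G$ (including those in $D$) has a neighbor in $D$; the total domination number $\gamma_t(G)$ is the minimum cardinality of a total dominating set of $G$. For an integer $k\ge 0$, a dominating set $D$ of $G$ is a $k$-limited dominating set if $|N_G(u)\setminus D|\le k$ for every $u\in D$, and $\gamma_k^{\mathrm L}(G)$ is the minimum cardinality of a $k$-limited dominating set of $G$. The hypercube $Q_d$ has vertex set $\{0,1\}^d$, two vertices being adjacent if and only if they differ in exactly one coordinate. -}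

module Defs where

open import Data.Bool using (Bool; true; false; not)
import Data.Bool.Properties as Bool
open import Data.Fin using (Fin; zero; suc)
import Data.Fin.Properties as Fin
open import Data.Fin.Subset using (Subset; ⊤; ∣_∣; _─_) renaming (_∈_ to _∈ᶠ_)
open import Data.Fin.Subset.Properties using (anySubset?; ∈⊤; p─⊤≡⊥; ∣⊥∣≡0) renaming (_∈?_ to _∈ᶠ?_)
open import Data.Nat using (ℕ; zero; suc; _^_; _≤_; _<_; _≤?_; _<?_; z≤n)
open import Data.Nat.Induction using (<-wellFounded)
open import Data.Nat.Properties using (≮⇒≥; ≤-reflexive; ≤-trans)
open import Data.Product using (∃; ∃!; _×_; _,_; proj₁; proj₂)
open import Data.Product.Function.NonDependent.Propositional using (_×-↔_)
open import Data.Vec using (Vec; []; _∷_; lookup; tabulate)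
open import Function using (_∘_)
open import Function.Bundles using (_↔_; mk↔ₛ′; module Inverse)
open import Function.Construct.Composition using (_↔-∘_)
open import Function.Construct.Symmetry using (↔-sym)
open import Induction.WellFounded using (Acc; acc)
open import Relation.Binary using (Rel; Symmetric; Irreflexive) renaming (Decidable to Decidable₂)
open import Relation.Binary.PropositionalEquality using (_≡_; _≢_; refl; sym; trans; cong; subst)
open import Relation.Nullary using (¬_; Dec; yes; no; ¬?; does)
open import Relation.Nullary.Decidable using (_×-dec_; _→-dec_; map′)
open import Relation.Unary using (Pred; Decidable)
open import Level using (0ℓ)

record Graph : Set₁ where
  infix 4 _~_ _~?_
  field
    V        : Set
    order    : ℕ
    V↔Fin    : V ↔ Fin order
    _~_      : Rel V 0ℓ
    _~?_     : Decidable₂ _~_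
    ~-sym    : Symmetric _~_
    ~-irrefl : Irreflexive _≡_ _~_

  open Inverse V↔Fin public
    using () renaming (to to index; from to vertex; strictlyInverseʳ to vertex-index)

IsMinimumCardinality : ∀ {n} → Pred (Subset n) 0ℓ → Pred ℕ 0ℓ
IsMinimumCardinality P m = (∃ λ D → P D × ∣ D ∣ ≡ m) × (∀ D → P D → m ≤ ∣ D ∣)

abstract
  minimumCardinality : ∀ {n} {P : Pred (Subset n) 0ℓ} →
                       Decidable P → ∃ P → ∃ (IsMinimumCardinality P)
  minimumCardinality {n} {P} P? (D₀ , p₀) = search D₀ p₀ (<-wellFounded _)
    where
    search : ∀ D → P D → Acc _<_ ∣ D ∣ → ∃ (IsMinimumCardinality P)
    search D p (acc rs) with anySubset? (λ E → P? E ×-dec (∣ E ∣ <? ∣ D ∣))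
    ... | yes (E , q , E<D) = search E q (rs E<D)
    ... | no  ¬smaller      =
      ∣ D ∣ , (D , p , refl) , λ E q → ≮⇒≥ λ E<D → ¬smaller (E , q , E<D)

module _ (G : Graph) where
  open Graph G

  -- A set of vertices is a Subset order, read through the bijection V↔Fin.
  VertexSet : Set
  VertexSet = Subset order

  infix 4 _∈_ _∉_ _∈?_

  _∈_ _∉_ : V → VertexSet → Set
  v ∈ D = index v ∈ᶠ D
  v ∉ D = ¬ (v ∈ D)

  _∈?_ : Decidable₂ _∈_
  v ∈? D = index v ∈ᶠ? D

  N : V → VertexSet
  N u = tabulate (λ i → does (u ~? vertex i))

  Dominating : VertexSet → Set
  Dominating D = ∀ u → u ∉ D → ∃ λ v → u ~ v × v ∈ D

  TotalDominating : VertexSet → Set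
  TotalDominating D = ∀ u → ∃ λ v → u ~ v × v ∈ D

  LimitedDominating : ℕ → VertexSet → Set
  LimitedDominating k D = Dominating D × (∀ u → u ∈ D → ∣ N u ─ D ∣ ≤ k)

  NoIsolatedVertex : Set
  NoIsolatedVertex = ∀ u → ∃ λ v → u ~ v

  allV? : {P : Pred V 0ℓ} → Decidable P → Dec (∀ v → P v)
  allV? {P} P? = map′ (λ f v → subst P (vertex-index v) (f (index v)))
                      (λ f i → f (vertex i))
                      (Fin.all? (P? ∘ vertex))

  anyV? : {P : Pred V 0ℓ} → Decidable P → Dec (∃ P)
  anyV? {P} P? = map′ (λ (i , p) → vertex i , p)
                      (λ (v , p) → index v , subst P (sym (vertex-index v)) p)
                      (Fin.any? (P? ∘ vertex))

  hasNeighbourIn? : ∀ D u → Dec (∃ λ v → u ~ v × v ∈ D)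
  hasNeighbourIn? D u = anyV? (λ v → (u ~? v) ×-dec (v ∈? D))

  dominating? : Decidable Dominating
  dominating? D = allV? (λ u → ¬? (u ∈? D) →-dec hasNeighbourIn? D u)

  totalDominating? : Decidable TotalDominating
  totalDominating? D = allV? (hasNeighbourIn? D)

  limitedDominating? : ∀ k → Decidable (LimitedDominating k)
  limitedDominating? k D =
    dominating? D ×-dec allV? (λ u → (u ∈? D) →-dec (∣ N u ─ D ∣ ≤? k))

  ⊤-dominating : Dominating ⊤
  ⊤-dominating u u∉⊤ with () ← u∉⊤ ∈⊤

  ⊤-totalDominating : NoIsolatedVertex → TotalDominating ⊤
  ⊤-totalDominating nbr u = let v , u~v = nbr u in v , u~v , ∈⊤

  ⊤-limitedDominating : ∀ k → LimitedDominating k ⊤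
  ⊤-limitedDominating k = ⊤-dominating , λ u _ →
    ≤-trans (≤-reflexive (trans (cong ∣_∣ (p─⊤≡⊥ (N u))) (∣⊥∣≡0 order))) z≤n

  γ-exists : ∃ (IsMinimumCardinality Dominating)
  γ-exists = minimumCardinality dominating? (⊤ , ⊤-dominating)

  γᵗ-exists : NoIsolatedVertex → ∃ (IsMinimumCardinality TotalDominating)
  γᵗ-exists nbr = minimumCardinality totalDominating? (⊤ , ⊤-totalDominating nbr)

  γᴸ-exists : ∀ k → ∃ (IsMinimumCardinality (LimitedDominating k))
  γᴸ-exists k = minimumCardinality (limitedDominating? k) (⊤ , ⊤-limitedDominating k)

γ : Graph → ℕ
γ G = proj₁ (γ-exists G)

-- A graph with an isolated vertex has no total dominating set.
γᵗ : (G : Graph) → NoIsolatedVertex G → ℕ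
γᵗ G nbr = proj₁ (γᵗ-exists G nbr)

γᴸ : ℕ → Graph → ℕ
γᴸ k G = proj₁ (γᴸ-exists G k)

DifferInOne : ∀ {d} → Rel (Vec Bool d) 0ℓ
DifferInOne u v = ∃! _≡_ λ i → lookup u i ≢ lookup v i

differInOne? : ∀ {d} → Decidable₂ (DifferInOne {d})
differInOne? u v =
  map′ (λ (i , p , h) → i , p , λ {j} → h j)
       (λ (i , p , h) → i , p , λ j → h {j})
       (Fin.any? λ i → differ? i ×-dec Fin.all? λ j → differ? j →-dec (i Fin.≟ j))
  where
  differ? : Decidable (λ i → lookup u i ≢ lookup v i)
  differ? i = ¬? (lookup u i Bool.≟ lookup v i)

Vec-Bool↔Fin : ∀ d → Vec Bool d ↔ Fin (2 ^ d)
Vec-Bool↔Fin zero    = mk↔ₛ′ (λ _ → zero) (λ _ → []) (λ { zero → refl }) (λ { [] → refl })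
Vec-Bool↔Fin (suc d) =
  ↔-sym Fin.*↔× ↔-∘ ((↔-sym Fin.2↔Bool ×-↔ Vec-Bool↔Fin d) ↔-∘ uncons↔)
  where
  uncons↔ : Vec Bool (suc d) ↔ (Bool × Vec Bool d)
  uncons↔ = mk↔ₛ′ (λ { (b ∷ v) → b , v }) (λ (b , v) → b ∷ v)
                  (λ _ → refl) (λ { (b ∷ v) → refl })

Q : ℕ → Graph
Q d = record
  { V        = Vec Bool d
  ; order    = 2 ^ d
  ; V↔Fin    = Vec-Bool↔Fin d
  ; _~_      = DifferInOne
  ; _~?_     = differInOne?
  ; ~-sym    = λ (i , p , h) → i , p ∘ sym , λ q → h (q ∘ sym)
  ; ~-irrefl = λ { refl (i , p , _) → p refl }
  }

Q-noIsolatedVertex : ∀ d → NoIsolatedVertex (Q (suc d))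
Q-noIsolatedVertex d (b ∷ v) = not b ∷ v , zero , Bool.not-¬ refl , unique
  where
  unique : ∀ {i} → lookup (b ∷ v) i ≢ lookup (not b ∷ v) i → zero ≡ i
  unique {zero}  _ = refl
  unique {suc i} p with () ← p refl

{-# OPTIONS --safe #-}

-- Q_{d+1} is regular of degree d + 1, so "at most d neighbours outside D" says
-- exactly "some neighbour inside D": d-limited and total domination agree there.
--
-- If D dominates Q_d then {0,1} × D totally dominates Q_{d+1}. Conversely, Q_{d+1}
-- is bipartite by parity, and forgetting the first coordinate identifies either
-- parity class with Q_d. Since all neighbours of a vertex have the opposite parity,
-- each class of a total dominating set D projects onto a dominating set of Q_d;
-- the two projections together have |D| elements.
module Submission where

open import Defs
open import Algebra.Properties.CommutativeSemigroup using (interchange)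
open import Data.Bool using (Bool; true; false; not; _xor_; if_then_else_)
import Data.Bool.Properties as Bool
open import Data.Fin using (Fin; zero; suc; _↑ˡ_)
import Data.Fin.Properties as Fin
open import Data.Fin.Subset using (Subset; ∣_∣; _─_) renaming (_∈_ to _∈ᶠ_)
open import Data.Fin.Subset.Properties
  using (x∈p∩q⁺; p⊆q⇒∣p∣≤∣q∣; x∈p∧x∉q⇒x∈p─q; p∩q≢∅⇒∣p─q∣<∣p∣)
open import Data.Nat using (ℕ; zero; suc; _+_; _*_; _^_; _≤_)
open import Data.Nat.Properties
  using (≤-refl; ≤-reflexive; ≤-trans; ≤-antisym; ≤-pred; 1+n≰n; module ≤-Reasoning;
         +-comm; +-identityʳ; +-mono-≤; +-commutativeSemigroup)
open import Data.Product using (∃; _×_; _,_; proj₁; proj₂)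
open import Data.Sum using (_⊎_; inj₁; inj₂)
open import Data.Vec using (Vec; []; _∷_; _++_; lookup; tabulate; splitAt)
open import Data.Vec.Properties
  using (≡-dec; []=⇒lookup; lookup⇒[]=; lookup∘tabulate; lookup-++ˡ; lookup-++ʳ)
open import Data.Vec.Relation.Binary.Pointwise.Extensional using (ext; Pointwise-≡⇒≡)
open import Function using (_∘_; flip)
open import Function.Bundles using (_⇔_; mk⇔; module Inverse)
open import Relation.Binary.PropositionalEquality
  using (_≡_; _≢_; refl; sym; trans; cong; cong₂; subst; module ≡-Reasoning)
open import Relation.Nullary using (yes; no; does; contradiction)
open import Relation.Nullary.Decidable using (does-⇔; dec-true; decidable-stable)

-- Limited and total domination in regular graphs

minimumCardinality-antimono :
  ∀ {m n a b} {P : Subset m → Set} {R : Subset n → Set} →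
  IsMinimumCardinality P a → IsMinimumCardinality R b →
  (∀ D → P D → ∃ λ E → R E × ∣ E ∣ ≤ ∣ D ∣) → b ≤ a
minimumCardinality-antimono ((D , p , refl) , _) (_ , least) f =
  let E , r , E≤D = f D p in ≤-trans (least E r) E≤D

module _ (G : Graph) where
  open Graph G
  open Inverse using (strictlyInverseˡ)

  lookup-tabulate∘vertex : ∀ {A : Set} (f : V → A) v →
                           lookup (tabulate (f ∘ vertex)) (index v) ≡ f v
  lookup-tabulate∘vertex f v = trans (lookup∘tabulate _ (index v)) (cong f (vertex-index v))

  ~⇒∈N : ∀ {u v} → u ~ v → index v ∈ᶠ N G u
  ~⇒∈N {u} {v} u~v = lookup⇒[]= _ _
    (trans (lookup-tabulate∘vertex (does ∘ (u ~?_)) v) (dec-true (u ~? v) u~v))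

  ∈N⇒~ : ∀ {u i} → i ∈ᶠ N G u → u ~ vertex i
  ∈N⇒~ {u} {i} i∈N with u ~? vertex i | trans (sym (lookup∘tabulate _ i)) ([]=⇒lookup i∈N)
  ... | yes u~v | _ = u~v

  -- A neighbour in `D` makes `N G u ─ D` strictly smaller than `N G u`, hence of size at most `k`.
  total⇒limited : ∀ {k D} → (∀ u → ∣ N G u ∣ ≤ suc k) →
                  TotalDominating G D → LimitedDominating G k D
  total⇒limited {D = D} deg≤ total =
    (λ u _ → total u) ,
    λ u _ → let v , u~v , v∈D = total u in
      ≤-pred (≤-trans (p∩q≢∅⇒∣p─q∣<∣p∣ (N G u) D (index v , x∈p∩q⁺ (~⇒∈N u~v , v∈D)))
                      (deg≤ u))

  -- Only `u ∈ D` is at issue: without a neighbour in `D`, all of `N G u` lies outside `D`, which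
  -- forces `suc k ≤ k`.
  limited⇒total : ∀ {k D} → (∀ u → suc k ≤ ∣ N G u ∣) →
                  LimitedDominating G k D → TotalDominating G D
  limited⇒total {D = D} deg≥ (dom , limited) u with hasNeighbourIn? G D u | _∈?_ G u D
  ... | yes nbr | _       = nbr
  ... | no  _   | no  u∉D = dom u u∉D
  ... | no ¬nbr | yes u∈D = contradiction
    (≤-trans (≤-trans (deg≥ u) (p⊆q⇒∣p∣≤∣q∣ N⊆N─D)) (limited u u∈D)) 1+n≰n
    where
    N⊆N─D : ∀ {i} → i ∈ᶠ N G u → i ∈ᶠ N G u ─ D
    N⊆N─D {i} i∈N = x∈p∧x∉q⇒x∈p─q i∈N λ i∈D →
      ¬nbr (vertex i , ∈N⇒~ i∈N ,
            subst (_∈ᶠ D) (sym (strictlyInverseˡ V↔Fin i)) i∈D)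

  regular⇒γᴸ≡γᵗ : ∀ {k} (nbr : NoIsolatedVertex G) → (∀ u → ∣ N G u ∣ ≡ suc k) →
                  γᴸ k G ≡ γᵗ G nbr
  regular⇒γᴸ≡γᵗ {k} nbr deg = ≤-antisym
    (minimumCardinality-antimono (proj₂ (γᵗ-exists G nbr)) (proj₂ (γᴸ-exists G k))
      λ D t → D , total⇒limited (≤-reflexive ∘ deg) t , ≤-refl)
    (minimumCardinality-antimono (proj₂ (γᴸ-exists G k)) (proj₂ (γᵗ-exists G nbr))
      λ D l → D , limited⇒total (≤-reflexive ∘ sym ∘ deg) l , ≤-refl)

-- Cardinalities as sums over bit vectors

∑ : ∀ {d} → (Vec Bool d → ℕ) → ℕ
∑ {zero}  f = f []
∑ {suc d} f = ∑ (f ∘ (false ∷_)) + ∑ (f ∘ (true ∷_))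

∑-cong : ∀ {d} {f g : Vec Bool d → ℕ} → (∀ v → f v ≡ g v) → ∑ f ≡ ∑ g
∑-cong {zero}  f≗g = f≗g []
∑-cong {suc d} f≗g = cong₂ _+_ (∑-cong (f≗g ∘ (false ∷_))) (∑-cong (f≗g ∘ (true ∷_)))

∑-distrib-+ : ∀ {d} (f g : Vec Bool d → ℕ) → ∑ (λ v → f v + g v) ≡ ∑ f + ∑ g
∑-distrib-+ {zero}  f g = refl
∑-distrib-+ {suc d} f g =
  trans (cong₂ _+_ (∑-distrib-+ _ (g ∘ (false ∷_))) (∑-distrib-+ _ (g ∘ (true ∷_))))
        (interchange +-commutativeSemigroup (∑ (f ∘ (false ∷_))) _ _ _)

⟦_⟧ : Bool → ℕ
⟦ b ⟧ = if b then 1 else 0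

index : ∀ {d} → Vec Bool d → Fin (2 ^ d)
index {d} = Graph.index (Q d)

vertex : ∀ {d} → Fin (2 ^ d) → Vec Bool d
vertex {d} = Graph.vertex (Q d)

∣++∣ : ∀ {m n} (p : Subset m) (q : Subset n) → ∣ p ++ q ∣ ≡ ∣ p ∣ + ∣ q ∣
∣++∣ []          q = refl
∣++∣ (true  ∷ p) q = cong suc (∣++∣ p q)
∣++∣ (false ∷ p) q = ∣++∣ p q

-- Q (suc d) has order 2 ^ d + (2 ^ d + 0), whence the trailing [].
lookup-halves : ∀ d (p q : Subset (2 ^ d)) b (v : Vec Bool d) →
                lookup (p ++ (q ++ [])) (index (b ∷ v)) ≡ lookup (if b then q else p) (index v)
lookup-halves d p q false v = lookup-++ˡ p (q ++ []) (index v)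
lookup-halves d p q true  v =
  trans (lookup-++ʳ p (q ++ []) (index v ↑ˡ 0)) (lookup-++ˡ q [] (index v))

-- `index` puts the vertices with first bit `false` in the first `2 ^ d` positions, so splitting `p`
-- there matches the recursion of `∑`.
∣p∣≡∑ : ∀ d (p : Subset (2 ^ d)) → ∣ p ∣ ≡ ∑ (λ (v : Vec Bool d) → ⟦ lookup p (index v) ⟧)
∣p∣≡∑ zero  (true  ∷ []) = refl
∣p∣≡∑ zero  (false ∷ []) = refl
∣p∣≡∑ (suc d) p with splitAt (2 ^ d) p
... | p₀ , q , refl with splitAt (2 ^ d) q
... | p₁ , [] , refl = begin
  ∣ p₀ ++ (p₁ ++ []) ∣    ≡⟨ ∣++∣ p₀ (p₁ ++ []) ⟩
  ∣ p₀ ∣ + ∣ p₁ ++ [] ∣    ≡⟨ cong (∣ p₀ ∣ +_) (trans (∣++∣ p₁ []) (+-identityʳ _)) ⟩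
  ∣ p₀ ∣ + ∣ p₁ ∣          ≡⟨ cong₂ _+_ (half false p₀ refl) (half true p₁ refl) ⟩
  ∑ {suc d} (λ v → ⟦ lookup (p₀ ++ (p₁ ++ [])) (index v) ⟧) ∎
  where
  open ≡-Reasoning
  half : ∀ b r → (if b then p₁ else p₀) ≡ r →
         ∣ r ∣ ≡ ∑ {d} (λ v → ⟦ lookup (p₀ ++ (p₁ ++ [])) (index (b ∷ v)) ⟧)
  half b r refl = trans (∣p∣≡∑ d r) (∑-cong (cong ⟦_⟧ ∘ sym ∘ lookup-halves d p₀ p₁ b))

∣tabulate∣≡∑ : ∀ {d} (f : Vec Bool d → Bool) → ∣ tabulate (f ∘ vertex) ∣ ≡ ∑ (⟦_⟧ ∘ f)
∣tabulate∣≡∑ {d} f =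
  trans (∣p∣≡∑ d (tabulate (f ∘ vertex))) (∑-cong (cong ⟦_⟧ ∘ lookup-tabulate∘vertex (Q d) f))

-- Adjacency by first coordinate, and the degree of the cube

∷-differInOne⁻ : ∀ {d b c} {u v : Vec Bool d} → DifferInOne (b ∷ u) (c ∷ v) →
                 (b ≢ c × u ≡ v) ⊎ (b ≡ c × DifferInOne u v)
∷-differInOne⁻ {u = u} {v} (zero , b≢c , unique) =
  inj₁ (b≢c , Pointwise-≡⇒≡ (ext λ i →
    -- A disagreement of the tails at `i` would give `zero ≡ suc i` by uniqueness.
    decidable-stable (lookup u i Bool.≟ lookup v i) (flip contradiction (λ ()) ∘ unique {suc i})))
∷-differInOne⁻ {b = b} {c} (suc i , ui≢vi , unique) with b Bool.≟ c
... | yes b≡c = inj₂ (b≡c , i , ui≢vi , Fin.suc-injective ∘ unique)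
... | no  b≢c with () ← unique {zero} b≢c

differInOne-zero : ∀ {d b c} {u v : Vec Bool d} → b ≢ c → u ≡ v → DifferInOne (b ∷ u) (c ∷ v)
differInOne-zero b≢c refl =
  zero , b≢c , λ { {zero} _ → refl ; {suc i} ui≢ui → contradiction refl ui≢ui }

differInOne-suc : ∀ {d b} {u v : Vec Bool d} → DifferInOne u v → DifferInOne (b ∷ u) (b ∷ v)
differInOne-suc (i , ui≢vi , unique) =
  suc i , ui≢vi , λ { {zero} b≢b → contradiction refl b≢b ; {suc j} uj≢vj → cong suc (unique uj≢vj) }

-- An equivalence, so that `does-⇔` can swap the two decision procedures inside the degree count.
differInOne-∷≡ : ∀ {d} b {u v : Vec Bool d} → DifferInOne (b ∷ u) (b ∷ v) ⇔ DifferInOne u v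
differInOne-∷≡ b = mk⇔ to differInOne-suc
  where
  to : ∀ {d} {u v : Vec Bool d} → DifferInOne (b ∷ u) (b ∷ v) → DifferInOne u v
  to e with ∷-differInOne⁻ e
  ... | inj₁ (b≢b , _) = contradiction refl b≢b
  ... | inj₂ (_ , u~v) = u~v

differInOne-∷≢ : ∀ {d b c} {u v : Vec Bool d} → b ≢ c → DifferInOne (b ∷ u) (c ∷ v) ⇔ u ≡ v
differInOne-∷≢ {b = b} {c} b≢c = mk⇔ to (differInOne-zero b≢c)
  where
  to : ∀ {d} {u v : Vec Bool d} → DifferInOne (b ∷ u) (c ∷ v) → u ≡ v
  to e with ∷-differInOne⁻ e
  ... | inj₁ (_ , u≡v) = u≡v
  ... | inj₂ (b≡c , _) = contradiction b≡c b≢c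

∑-zero : ∀ d → ∑ {d} (λ _ → 0) ≡ 0
∑-zero zero    = refl
∑-zero (suc d) = cong₂ _+_ (∑-zero d) (∑-zero d)

∑-≡-indicator : ∀ {d} (u : Vec Bool d) → ∑ (λ v → ⟦ does (≡-dec Bool._≟_ u v) ⟧) ≡ 1
∑-≡-indicator []                  = refl
-- In the half with the other first bit, `does` computes to `false` throughout.
∑-≡-indicator {suc d} (false ∷ u) = cong₂ _+_ (∑-≡-indicator u) (∑-zero d)
∑-≡-indicator {suc d} (true  ∷ u) = cong₂ _+_ (∑-zero d) (∑-≡-indicator u)

-- Declared ahead of its clauses because the induction passes through the next two lemmas: in
-- dimension `suc d`, the half containing `u` contributes `d` and the other half contributes 1.
∑-~-indicator : ∀ {d} (u : Vec Bool d) → ∑ (λ v → ⟦ does (differInOne? u v) ⟧) ≡ d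

∑-~-indicator-∷≡ : ∀ {d} b (u : Vec Bool d) →
                   ∑ (λ v → ⟦ does (differInOne? (b ∷ u) (b ∷ v)) ⟧) ≡ d
∑-~-indicator-∷≡ b u = trans
  (∑-cong λ v → cong ⟦_⟧
    (does-⇔ (differInOne-∷≡ b) (differInOne? (b ∷ u) (b ∷ v)) (differInOne? u v)))
  (∑-~-indicator u)

∑-~-indicator-∷≢ : ∀ {d b c} → b ≢ c → (u : Vec Bool d) →
                   ∑ (λ v → ⟦ does (differInOne? (b ∷ u) (c ∷ v)) ⟧) ≡ 1
∑-~-indicator-∷≢ {b = b} {c} b≢c u = trans
  (∑-cong λ v → cong ⟦_⟧
    (does-⇔ (differInOne-∷≢ b≢c) (differInOne? (b ∷ u) (c ∷ v)) (≡-dec Bool._≟_ u v)))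
  (∑-≡-indicator u)

∑-~-indicator []                  = refl
∑-~-indicator {suc d} (false ∷ u) =
  trans (cong₂ _+_ (∑-~-indicator-∷≡ false u) (∑-~-indicator-∷≢ (λ ()) u)) (+-comm d 1)
∑-~-indicator {suc d} (true  ∷ u) =
  cong₂ _+_ (∑-~-indicator-∷≢ (λ ()) u) (∑-~-indicator-∷≡ true u)

Q-regular : ∀ {d} (u : Vec Bool d) → ∣ N (Q d) u ∣ ≡ d
Q-regular u = trans (∣tabulate∣≡∑ (does ∘ differInOne? u)) (∑-~-indicator u)

-- Doubling a dominating set

∈-doubled : ∀ d {D} b {v : Vec Bool d} → _∈_ (Q d) v D → _∈_ (Q (suc d)) (b ∷ v) (D ++ (D ++ []))
∈-doubled d {D} b {v} v∈D = lookup⇒[]= _ _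
  (trans (lookup-halves d D D b v)
    (trans (cong (flip lookup (index v)) (Bool.if-eta b)) ([]=⇒lookup v∈D)))

-- If `u ∈ D`, the copy of `u` in the opposite half serves as neighbour; otherwise the copy, in the
-- same half, of a neighbour dominating `u`.
doubled-totalDominating : ∀ d {D} → Dominating (Q d) D → TotalDominating (Q (suc d)) (D ++ (D ++ []))
doubled-totalDominating d {D} dom (b ∷ u) with _∈?_ (Q d) u D
... | yes u∈D = not b ∷ u , differInOne-zero (Bool.not-¬ refl) refl , ∈-doubled d (not b) u∈D
... | no u∉D  =
  let v , u~v , v∈D = dom u u∉D in b ∷ v , differInOne-suc u~v , ∈-doubled d b v∈D

∣doubled∣ : ∀ {n} (D : Subset n) → ∣ D ++ (D ++ []) ∣ ≡ 2 * ∣ D ∣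
∣doubled∣ D = trans (∣++∣ D (D ++ [])) (cong (∣ D ∣ +_) (∣++∣ D []))

-- Parity classes and their projections

parity : ∀ {d} → Vec Bool d → Bool
parity []      = false
parity (b ∷ v) = b xor parity v

~⇒parity≡not : ∀ {d} {u v : Vec Bool d} → DifferInOne u v → parity v ≡ not (parity u)
~⇒parity≡not {u = b ∷ u} {c ∷ v} e with ∷-differInOne⁻ e
... | inj₁ (b≢c , refl) =
  trans (cong (_xor parity u) (Bool.¬-not (b≢c ∘ sym))) (sym (Bool.not-distribˡ-xor b (parity u)))
... | inj₂ (refl , u~v) =
  trans (cong (b xor_) (~⇒parity≡not {u = u} {v} u~v)) (sym (Bool.not-distribʳ-xor b (parity u)))

-- The unique vertex of Q (suc d) of parity b above v.
lift : ∀ {d} → Bool → Vec Bool d → Vec Bool (suc d)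
lift b v = (b xor parity v) ∷ v

-- Encoded as a preimage under `lift b`; this equals the image of the parity-`b` part of `D` under
-- forgetting the first coordinate.
classProjection : ∀ d → Bool → Subset (2 ^ suc d) → Subset (2 ^ d)
classProjection d b D = tabulate ((λ v → lookup D (index (lift b v))) ∘ vertex {d})

∈-classProjection⁺ : ∀ {d b D} {v : Vec Bool d} →
                     _∈_ (Q (suc d)) (lift b v) D → _∈_ (Q d) v (classProjection d b D)
∈-classProjection⁺ {d} {b} {D} {v} lift∈D = lookup⇒[]= _ _
  (trans (lookup-tabulate∘vertex (Q d) (λ v → lookup D (index (lift b v))) v) ([]=⇒lookup lift∈D))

-- A neighbour of lift (not b) u has parity b, so it is the lift of u itself or of a neighbour of u.
classProjection-dominating : ∀ d {D} b → TotalDominating (Q (suc d)) D →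
                             Dominating (Q d) (classProjection d b D)
classProjection-dominating d {D} b total u u∉E with total (lift (not b) u)
... | c ∷ v , e , w∈D with ∷-differInOne⁻ e
...   | inj₁ (≢c , refl) = contradiction
  (∈-classProjection⁺ {d} {b} {D} {u}
    (subst (λ x → _∈_ (Q (suc d)) (x ∷ u) D) c≡ w∈D))
  u∉E
  where
  c≡ : c ≡ b xor parity u
  c≡ = trans (Bool.¬-not (≢c ∘ sym))
    (trans (Bool.not-distribˡ-xor (not b) (parity u)) (cong (_xor parity u) (Bool.not-involutive b)))
...   | inj₂ (refl , u~v) = v , u~v , ∈-classProjection⁺ {d} {b} {D} {v}
    (subst (λ x → _∈_ (Q (suc d)) (x ∷ v) D) c≡ w∈D)
  where
  c≡ : not b xor parity u ≡ b xor parity v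
  -- The negation moves from `b` to `parity u`, where the edge from `u` to `v` absorbs it.
  c≡ = trans (sym (Bool.not-distribˡ-xor b (parity u)))
    (trans (Bool.not-distribʳ-xor b (parity u)) (cong (b xor_) (sym (~⇒parity≡not {u = u} {v} u~v))))

-- Over each `v`, the two lifts are `false ∷ v` and `true ∷ v`, in an order decided by `parity v`.
∣classProjections∣ : ∀ d (D : Subset (2 ^ suc d)) →
  ∣ classProjection d false D ∣ + ∣ classProjection d true D ∣ ≡ ∣ D ∣
∣classProjections∣ d D = begin
  ∣ classProjection d false D ∣ + ∣ classProjection d true D ∣
    ≡⟨ cong₂ _+_ (∣tabulate∣≡∑ (χ ∘ lift false)) (∣tabulate∣≡∑ (χ ∘ lift true)) ⟩
  ∑ (⟦_⟧ ∘ χ ∘ lift false) + ∑ (⟦_⟧ ∘ χ ∘ lift true)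
    ≡⟨ ∑-distrib-+ (⟦_⟧ ∘ χ ∘ lift false) _ ⟨
  ∑ (λ v → ⟦ χ (lift false v) ⟧ + ⟦ χ (lift true v) ⟧)
    ≡⟨ ∑-cong (λ v → swap (parity v) v) ⟩
  ∑ (λ v → ⟦ χ (false ∷ v) ⟧ + ⟦ χ (true ∷ v) ⟧)
    ≡⟨ ∑-distrib-+ (⟦_⟧ ∘ χ ∘ (false ∷_)) _ ⟩
  ∑ (⟦_⟧ ∘ χ)
    ≡⟨ ∣p∣≡∑ (suc d) D ⟨
  ∣ D ∣ ∎
  where
  open ≡-Reasoning
  χ : Vec Bool (suc d) → Bool
  χ v = lookup D (index v)
  swap : ∀ p v → ⟦ χ (p ∷ v) ⟧ + ⟦ χ (not p ∷ v) ⟧ ≡ ⟦ χ (false ∷ v) ⟧ + ⟦ χ (true ∷ v) ⟧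
  swap false v = refl
  swap true  v = +-comm ⟦ χ (true ∷ v) ⟧ _

γᵗ≡2γ : ∀ d → γᵗ (Q (suc d)) (Q-noIsolatedVertex d) ≡ 2 * γ (Q d)
γᵗ≡2γ d with γ-exists (Q d) | γᵗ-exists (Q (suc d)) (Q-noIsolatedVertex d)
-- `D` and `T` attain the two minima, so the claim becomes an equality between `∣ T ∣` and
-- `2 * ∣ D ∣`.
... | _ , (D , dom , refl) , least | _ , (T , total , refl) , leastᵗ = ≤-antisym
  (≤-trans (leastᵗ _ (doubled-totalDominating d dom)) (≤-reflexive (∣doubled∣ D)))
  (begin
    2 * ∣ D ∣
      ≡⟨ cong (∣ D ∣ +_) (+-identityʳ ∣ D ∣) ⟩
    ∣ D ∣ + ∣ D ∣
      ≤⟨ +-mono-≤ (least _ (classProjection-dominating d false total))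
                  (least _ (classProjection-dominating d true total)) ⟩
    ∣ classProjection d false T ∣ + ∣ classProjection d true T ∣
      ≡⟨ ∣classProjections∣ d T ⟩
    ∣ T ∣ ∎)
  where open ≤-Reasoning

corollary19 : (d : ℕ) → 1 ≤ d →
    (γᴸ d (Q (suc d)) ≡ γᵗ (Q (suc d)) (Q-noIsolatedVertex d)) ×
    (γᵗ (Q (suc d)) (Q-noIsolatedVertex d) ≡ 2 * γ (Q d))
corollary19 d _ = regular⇒γᴸ≡γᵗ (Q (suc d)) (Q-noIsolatedVertex d) Q-regular , γᵗ≡2γ d
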